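{- Let $T=(V,E)$ be a tree with at least two vertices, with unit edge lengths $\ell\equiv 1$, unit interdiction costs $b\equiv 1$, interdiction budget $B=1$ and number of locations $p=B+1=2$. Let $X^*\subseteq V$ be the set of optimal solutions (vertices) of the $1$-median location problem on $T$, i.e. the vertices $x$ minimizing $\sum_{v\in V} d_T(v,x)$. Choose a leaf $v$ of $T$ that minimizes $\min_{r^*\in X^*} d_T(r^*,v)$ among all leaves of $T$. Then interdicting the (unique) edge incident to $v$ is an optimal interdiction strategy for the $p$-median location interdiction problem on $T$.
   Context: $p$-median location interdiction problem (optimization version): given an undirected graph $G=(V,E)$, edge lengths $\ell$, interdiction costs $b$, budget $B$ and integer $p$, an interdiction strategy is a vector $\gamma\in\{0,1\}^{E}$ with $\sum_{e} b(e)\gamma_e\le B$, inducing $G(\gamma)=(V,E\setminus\{e:\gamma_e=1\})$. Its value is $\min_{X\subseteq V,|X|=p}\sum_{v\in V} d_{G(\gamma)}(v,X)$, where $d_{G(\gamma)}(v,X)=\min_{x\in X} d_{G(\gamma)}(v,x)$ and $d_{G(\gamma)}$ is the shortest-path distance in $G(\gamma)$ w.r.t. $\ell$ (infinite if no path exists). A strategy is optimal if it maximizes this value over all interdiction strategies. -}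

module Defs where

open import Data.Nat using (ℕ; zero; suc; _+_; _≤_; _⊓_; _≥_)
open import Data.Fin using (Fin; _≟_)
open import Data.Fin.Properties using ()
open import Data.Bool using (Bool; true; false; _∨_; _∧_; if_then_else_; not)
open import Data.List using (List; []; _∷_; allFin; foldr; concatMap)
open import Data.Bool.ListAction using (any)
open import Data.Product using (_×_; _,_; proj₁; proj₂; Σ; ∃; ∃-syntax)
open import Data.Sum using (_⊎_)
open import Relation.Binary.PropositionalEquality using (_≡_; _≢_)
open import Relation.Nullary using (¬_)
open import Relation.Nullary.Decidable using (⌊_⌋)
open import Function using (Injective)

data ℕ∞ : Set where
  fin : ℕ → ℕ∞
  ∞   : ℕ∞

infixl 6 _+∞_
_+∞_ : ℕ∞ → ℕ∞ → ℕ∞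
fin a +∞ fin b = fin (a + b)
fin _ +∞ ∞     = ∞
∞     +∞ _     = ∞

min∞ : ℕ∞ → ℕ∞ → ℕ∞
min∞ (fin a) (fin b) = fin (a ⊓ b)
min∞ (fin a) ∞       = fin a
min∞ ∞       y       = y

infix 4 _≤∞_
data _≤∞_ : ℕ∞ → ℕ∞ → Set where
  fin≤fin : ∀ {a b} → a ≤ b → fin a ≤∞ fin b
  _≤∞∞    : ∀ x → x ≤∞ ∞

sum∞ : ∀ n → (Fin n → ℕ∞) → ℕ∞
sum∞ zero    f = fin 0
sum∞ (suc n) f = f Fin.zero +∞ sum∞ n (λ i → f (Fin.suc i))

-- Undirected graphs on vertex set Fin n with m edges indexed by Fin m.
-- Edge e joins the endpoints proj₁ (E e) and proj₂ (E e).

Edges : ℕ → ℕ → Set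
Edges n m = Fin m → Fin n × Fin n

Incident : ∀ {n m} → Edges n m → Fin m → Fin n → Set
Incident E e v = proj₁ (E e) ≡ v ⊎ proj₂ (E e) ≡ v

Adjacent : ∀ {n m} → Edges n m → Fin n → Fin n → Set
Adjacent E u v = ∃[ e ] ((E e ≡ (u , v)) ⊎ (E e ≡ (v , u)))

Simple : ∀ {n m} → Edges n m → Set
Simple {n} {m} E =
  (∀ e → proj₁ (E e) ≢ proj₂ (E e)) ×
  (∀ e f → (E e ≡ E f ⊎ E e ≡ (proj₂ (E f) , proj₁ (E f))) → e ≡ f)

data Walk {n m} (E : Edges n m) : Fin n → Fin n → ℕ → Set where
  here : ∀ {u} → Walk E u u 0
  step : ∀ {u w v k} → Adjacent E u w → Walk E w v k → Walk E u v (suc k)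

Connected : ∀ {n m} → Edges n m → Set
Connected E = ∀ u v → ∃[ k ] Walk E u v k

record Cycle {n m} (E : Edges n m) : Set where
  field
    len   : ℕ
    len≥3 : len ≥ 3
    vtx   : Fin len → Fin n
    inj   : Injective _≡_ _≡_ vtx
    adj   : ∀ (i j : Fin len) →
            (Data.Fin.toℕ j ≡ suc (Data.Fin.toℕ i) ⊎
             (Data.Fin.toℕ j ≡ 0 × suc (Data.Fin.toℕ i) ≡ len)) →
            Adjacent E (vtx i) (vtx j)

IsTree : ∀ {n m} → Edges n m → Set
IsTree E = Simple E × Connected E × ¬ Cycle E

Leaf : ∀ {n m} → Edges n m → Fin n → Set
Leaf E v = ∃[ e ] (Incident E e v × (∀ f → Incident E f v → f ≡ e))

-- Interdiction strategies γ ∈ {0,1}^E (true = edge removed), unit costs.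

Strategy : ℕ → Set
Strategy m = Fin m → Bool

count : ∀ {m} → Strategy m → ℕ
count {zero}  γ = 0
count {suc m} γ = (if γ Fin.zero then 1 else 0) + count (λ i → γ (Fin.suc i))

Feasible : ∀ {m} → ℕ → Strategy m → Set
Feasible B γ = count γ ≤ B

only : ∀ {m} → Fin m → Strategy m
only e f = ⌊ e ≟ f ⌋

within : ∀ {n m} → Edges n m → Strategy m → ℕ → Fin n → Fin n → Bool
within {n} {m} E γ zero    u v = ⌊ u ≟ v ⌋
within {n} {m} E γ (suc k) u v =
  within E γ k u v ∨
  any (λ e → not (γ e) ∧
         ((within E γ k u (proj₁ (E e)) ∧ ⌊ proj₂ (E e) ≟ v ⌋) ∨
          (within E γ k u (proj₂ (E e)) ∧ ⌊ proj₁ (E e) ≟ v ⌋)))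
      (allFin m)

search : ∀ {n m} → Edges n m → Strategy m → Fin n → Fin n → ℕ → ℕ → ℕ∞
search E γ u v fuel k with within E γ k u v
... | true  = fin k
search E γ u v zero     k | false = ∞
search E γ u v (suc fl) k | false = search E γ u v fl (suc k)

-- shortest-path distance in G(γ) with unit edge lengths (∞ if no path).
-- A shortest walk on n vertices has < n edges, so searching k ≤ n suffices.
dist : ∀ {n m} → Edges n m → Strategy m → Fin n → Fin n → ℕ∞
dist {n} E γ u v = search E γ u v n 0

distT : ∀ {n m} → Edges n m → Fin n → Fin n → ℕ∞
distT E = dist E (λ _ → false)

medianCost : ∀ {n m} → Edges n m → Fin n → ℕ∞
medianCost {n} E x = sum∞ n (λ v → distT E v x)

IsOneMedian : ∀ {n m} → Edges n m → Fin n → Set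
IsOneMedian E x = ∀ y → medianCost E x ≤∞ medianCost E y

cost2 : ∀ {n m} → Edges n m → Strategy m → Fin n → Fin n → ℕ∞
cost2 {n} E γ x y = sum∞ n (λ v → min∞ (dist E γ v x) (dist E γ v y))

pairs : ∀ n → List (Fin n × Fin n)
pairs n = concatMap (λ x → concatMap (λ y → if ⌊ x ≟ y ⌋ then [] else (x , y) ∷ []) (allFin n)) (allFin n)

value2 : ∀ {n m} → Edges n m → Strategy m → ℕ∞
value2 {n} E γ = foldr (λ xy r → min∞ (cost2 E γ (proj₁ xy) (proj₂ xy)) r) ∞ (pairs n)

Optimal : ∀ {n m} → Edges n m → ℕ → Strategy m → Set
Optimal {m = m} E B γ = Feasible B γ × (∀ (γ' : Strategy m) → Feasible B γ' → value2 E γ' ≤∞ value2 E γ)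

{-# OPTIONS --safe #-}

-- Write d for the distance in the tree T and f(x) = Σ_u d(u, x).  Cutting the edge at the leaf v forces
-- one location onto v, so with y as the other one the cost is at least f(y) − d(y, v).  For an arbitrary
-- cut edge e with r on one side and w on the other, locating at r and at the endpoint b of e beyond r
-- saves d(r, b) for each vertex beyond e, of which there are at least 1 + d(b, w); hence it costs at most
-- f(r) − d(r, w), and w can be taken to be a leaf.  It remains to find, for every y, such r and w with
-- f(r) − d(r, w) ≤ f(y) − d(y, v).  If y is not a median, take any median r and let s be a median with
-- d(s, v) ≤ d(r, w): convexity of f gives f(y) ≥ f(s) + d(y, s) ≥ f(s) + d(y, v) − d(s, v).  If y is a
-- median, all medians are within distance 1 of y, and r is y itself or a neighbouring median, whichever
-- is farther from w; this makes up for the loss of 1, as distances to adjacent vertices differ by exactly 1.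

module Submission where

open import Defs
open import Data.Bool using (true; false; T; _∧_; _∨_; not; if_then_else_)
open import Data.Bool.Properties using (T-∧; T-∨)
open import Data.Fin using (Fin; toℕ) renaming (zero to fzero; suc to fsuc)
import Data.Fin as Fin
open import Data.Fin.Properties using (injective⇒≤)
open import Data.List using (List; []; _∷_; length; lookup; allFin; foldr)
open import Data.List.Extrema.Nat using (argmin; argmax; f[argmin]≤f[xs]; f[xs]≤f[argmax])
open import Data.List.Membership.Propositional using (_∈_; find; lose)
open import Data.List.Membership.Propositional.Properties using (∈-allFin; ∈-concatMap⁺; ∈-concatMap⁻; ∈-lookup)
open import Data.List.Relation.Unary.All as All using ([]; _∷_)
open import Data.List.Relation.Unary.All.Properties using (¬Any⇒All¬)
open import Data.List.Relation.Unary.AllPairs using ([]; _∷_)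
open import Data.List.Relation.Unary.Any using (here; there; any?)
open import Data.List.Relation.Unary.Any.Properties using (any⁺; any⁻)
open import Data.List.Relation.Unary.Unique.Propositional using (Unique)
open import Data.Nat using (ℕ; zero; suc; _+_; _*_; _≤_; _<_; _≥_; z≤n; s≤s; s≤s⁻¹; _≤?_)
open import Data.Nat.Properties
open import Data.Nat.Tactic.RingSolver using (solve-∀)
open import Data.Product using (_×_; _,_; proj₁; proj₂; ∃; ∃-syntax)
open import Data.Sum using (_⊎_; inj₁; inj₂; swap)
open import Data.Unit using (tt)
open import Function using (Equivalence; Injective; case_of_)
open import Relation.Binary.PropositionalEquality
open import Relation.Nullary using (¬_; yes; no; contradiction)
open import Relation.Nullary.Decidable using (⌊_⌋; fromWitness; toWitness)
open import Algebra.Properties.CommutativeMonoid.Sum +-0-commutativeMonoid using (sum; ∑-distrib-+)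
open import Algebra.Properties.Semiring.Sum +-*-semiring using (*-distribˡ-sum)

-- Lists without repetition and finite sums.

cancel-≤ : ∀ z {a b p q} → p ≡ z + a → q ≡ z + b → p ≤ q → a ≤ b
cancel-≤ z refl refl = +-cancelˡ-≤ z _ _

Unique⇒lookup-injective : ∀ {A : Set} {xs : List A} → Unique xs → Injective _≡_ _≡_ (lookup xs)
Unique⇒lookup-injective (_ ∷ _) {fzero} {fzero} _ = refl
Unique⇒lookup-injective {xs = _ ∷ xs} (x≢ ∷ _) {fzero} {fsuc j} eq = contradiction eq (All.lookup x≢ (∈-lookup {xs = xs} j))
Unique⇒lookup-injective {xs = _ ∷ xs} (x≢ ∷ _) {fsuc i} {fzero} eq = contradiction (sym eq) (All.lookup x≢ (∈-lookup {xs = xs} i))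
Unique⇒lookup-injective (_ ∷ u) {fsuc i} {fsuc j} eq = cong fsuc (Unique⇒lookup-injective u eq)

sum-mono-≤ : ∀ {n} {f g : Fin n → ℕ} → (∀ i → f i ≤ g i) → sum f ≤ sum g
sum-mono-≤ {zero}  f≤g = z≤n
sum-mono-≤ {suc n} f≤g = +-mono-≤ (f≤g fzero) (sum-mono-≤ (λ i → f≤g (fsuc i)))

-- A point mass at one index, used to add or remove a single term of a sum.
at : ∀ {n} → Fin n → ℕ → Fin n → ℕ
at fzero    k fzero    = k
at fzero    k (fsuc _) = 0
at (fsuc i) k fzero    = 0
at (fsuc i) k (fsuc j) = at i k j

at-≡ : ∀ {n} (i : Fin n) k → at i k i ≡ k
at-≡ fzero    k = refl
at-≡ (fsuc i) k = at-≡ i k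

at-≢ : ∀ {n} {i j : Fin n} k → i ≢ j → at i k j ≡ 0
at-≢ {i = fzero}  {fzero}  k i≢j = contradiction refl i≢j
at-≢ {i = fzero}  {fsuc j} k i≢j = refl
at-≢ {i = fsuc i} {fzero}  k i≢j = refl
at-≢ {i = fsuc i} {fsuc j} k i≢j = at-≢ k (λ eq → i≢j (cong fsuc eq))

sum-zero : ∀ n → sum {n} (λ _ → 0) ≡ 0
sum-zero zero    = refl
sum-zero (suc n) = sum-zero n

sum-at : ∀ {n} (i : Fin n) k → sum (at i k) ≡ k
sum-at {suc n} fzero    k = trans (cong (k +_) (sum-zero n)) (+-identityʳ k)
sum-at         (fsuc i) k = sum-at i k

-- Induction on the list: setting `f` to 0 at the head gives up at least 1 of the sum and, as the
-- head does not recur, changes nothing on the tail.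
length≤sum : ∀ {n} (f : Fin n → ℕ) {xs} → Unique xs → (∀ {x} → x ∈ xs → 1 ≤ f x) → length xs ≤ sum f
length≤sum f {[]}     _        _   = z≤n
length≤sum {n} f {x ∷ xs} (x∉ ∷ u) pos = begin
  1 + length xs                        ≤⟨ +-monoʳ-≤ 1 (length≤sum rest u rest-pos) ⟩
  1 + sum rest                         ≡⟨ cong (_+ sum rest) (sum-at x 1) ⟨
  sum (at x 1) + sum rest              ≡⟨ ∑-distrib-+ (at x 1) rest ⟨
  sum (λ y → at x 1 y + rest y)        ≤⟨ sum-mono-≤ split ⟩
  sum f ∎
  where
  open ≤-Reasoning
  rest : Fin n → ℕ
  rest y = if ⌊ x Fin.≟ y ⌋ then 0 else f y
  rest-pos : ∀ {y} → y ∈ xs → 1 ≤ rest y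
  rest-pos {y} y∈ with x Fin.≟ y
  ... | yes eq = contradiction eq (All.lookup x∉ y∈)
  ... | no _   = pos (there y∈)
  split : ∀ y → at x 1 y + rest y ≤ f y
  split y with x Fin.≟ y
  ... | yes refl = ≤-trans (≤-reflexive (trans (+-identityʳ _) (at-≡ x 1))) (pos (here refl))
  ... | no x≢y   = ≤-reflexive (cong (_+ f y) (at-≢ 1 x≢y))

-- Order and sums of the extended natural numbers.

≤∞-refl : ∀ {x} → x ≤∞ x
≤∞-refl {fin _} = fin≤fin ≤-refl
≤∞-refl {∞}     = ∞ ≤∞∞

≤∞-trans : ∀ {x y z} → x ≤∞ y → y ≤∞ z → x ≤∞ z
≤∞-trans (fin≤fin a≤b) (fin≤fin b≤c) = fin≤fin (≤-trans a≤b b≤c)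
≤∞-trans {x} _         (_ ≤∞∞)       = x ≤∞∞

0≤∞ : ∀ x → fin 0 ≤∞ x
0≤∞ (fin _) = fin≤fin z≤n
0≤∞ ∞       = fin 0 ≤∞∞

fin≤fin⁻¹ : ∀ {a b} → fin a ≤∞ fin b → a ≤ b
fin≤fin⁻¹ (fin≤fin a≤b) = a≤b

+∞-mono : ∀ {a b c d} → a ≤∞ c → b ≤∞ d → a +∞ b ≤∞ c +∞ d
+∞-mono (fin≤fin a≤c) (fin≤fin b≤d) = fin≤fin (+-mono-≤ a≤c b≤d)
+∞-mono (fin≤fin _)   (_ ≤∞∞)       = _ ≤∞∞
+∞-mono (_ ≤∞∞)       _             = _ ≤∞∞

min∞-≤ˡ : ∀ a b → min∞ a b ≤∞ a
min∞-≤ˡ (fin a) (fin b) = fin≤fin (m⊓n≤m a b)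
min∞-≤ˡ (fin a) ∞       = ≤∞-refl
min∞-≤ˡ ∞       b       = b ≤∞∞

min∞-≤ʳ : ∀ a b → min∞ a b ≤∞ b
min∞-≤ʳ (fin a) (fin b) = fin≤fin (m⊓n≤n a b)
min∞-≤ʳ (fin a) ∞       = fin a ≤∞∞
min∞-≤ʳ ∞       b       = ≤∞-refl

min∞-glb : ∀ {a b c} → c ≤∞ a → c ≤∞ b → c ≤∞ min∞ a b
min∞-glb (fin≤fin c≤a) (fin≤fin c≤b) = fin≤fin (⊓-glb c≤a c≤b)
min∞-glb (fin≤fin c≤a) (_ ≤∞∞)       = fin≤fin c≤a
min∞-glb (_ ≤∞∞)       c≤b           = c≤b

sum∞-mono : ∀ {n} {f g : Fin n → ℕ∞} → (∀ i → f i ≤∞ g i) → sum∞ n f ≤∞ sum∞ n g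
sum∞-mono {zero}  f≤g = ≤∞-refl
sum∞-mono {suc n} f≤g = +∞-mono (f≤g fzero) (sum∞-mono (λ i → f≤g (fsuc i)))

sum∞-fin : ∀ {n} {g : Fin n → ℕ∞} (f : Fin n → ℕ) → (∀ i → g i ≡ fin (f i)) → sum∞ n g ≡ fin (sum f)
sum∞-fin {zero}  f eq = refl
sum∞-fin {suc n} f eq = cong₂ _+∞_ (eq fzero) (sum∞-fin (λ i → f (fsuc i)) (λ i → eq (fsuc i)))

+∞-∞ : ∀ a → a +∞ ∞ ≡ ∞
+∞-∞ (fin _) = refl
+∞-∞ ∞       = refl

sum∞-∞ : ∀ {n} (f : Fin n → ℕ∞) i → f i ≡ ∞ → sum∞ n f ≡ ∞
sum∞-∞ {suc n} f fzero eq = cong (_+∞ sum∞ n (λ i → f (fsuc i))) eq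
sum∞-∞ f (fsuc i) eq = trans (cong (f fzero +∞_) (sum∞-∞ (λ j → f (fsuc j)) i eq)) (+∞-∞ _)

-- Pairs of locations and the value of a strategy.

pairs⁺ : ∀ {n} {x y : Fin n} → x ≢ y → (x , y) ∈ pairs n
pairs⁺ {n} {x} {y} x≢y = ∈-concatMap⁺ _ (lose (∈-allFin x) (∈-concatMap⁺ _ (lose (∈-allFin y) mem)))
  where
  mem : (x , y) ∈ (if ⌊ x Fin.≟ y ⌋ then [] else (x , y) ∷ [])
  mem with x Fin.≟ y
  ... | yes x≡y = contradiction x≡y x≢y
  ... | no _    = here refl

pairs⁻ : ∀ {n} {x y : Fin n} → (x , y) ∈ pairs n → x ≢ y
pairs⁻ {n} {x} {y} mem
  with x′ , _ , mem₁ ← find (∈-concatMap⁻ _ {xs = allFin n} mem)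
  with y′ , _ , mem₂ ← find (∈-concatMap⁻ _ {xs = allFin n} mem₁)
  with x′ Fin.≟ y′ | mem₂
... | no x≢y | here refl = x≢y

module _ {n m : ℕ} (E : Edges n m) (γ : Strategy m) where

  value2-≤ : ∀ {x y} → x ≢ y → value2 E γ ≤∞ cost2 E γ x y
  value2-≤ x≢y = go (pairs⁺ x≢y)
    where
    go : ∀ {x y ps} → (x , y) ∈ ps →
         foldr (λ xy r → min∞ (cost2 E γ (proj₁ xy) (proj₂ xy)) r) ∞ ps ≤∞ cost2 E γ x y
    go (here refl) = min∞-≤ˡ _ _
    go (there mem) = ≤∞-trans (min∞-≤ʳ _ _) (go mem)

  value2-glb : ∀ {c} → (∀ x y → x ≢ y → c ≤∞ cost2 E γ x y) → c ≤∞ value2 E γ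
  value2-glb {c} h = go (pairs n) (λ mem → h _ _ (pairs⁻ mem))
    where
    go : ∀ ps → (∀ {x y} → (x , y) ∈ ps → c ≤∞ cost2 E γ x y) →
         c ≤∞ foldr (λ xy r → min∞ (cost2 E γ (proj₁ xy) (proj₂ xy)) r) ∞ ps
    go []       _ = c ≤∞∞
    go (p ∷ ps) h = min∞-glb (h (here refl)) (go ps (λ mem → h (there mem)))

-- Routes and distances under a strategy.

module Walks {n m : ℕ} (E : Edges n m) where

  Joins : Fin m → Fin n → Fin n → Set
  Joins e u w = E e ≡ (u , w) ⊎ E e ≡ (w , u)

  infixl 5 _▸_
  -- Unlike `Walk`, a route avoids the removed edges and grows at its far end, just as the recursion
  -- of `within` does.
  data Route (γ : Strategy m) (u : Fin n) : Fin n → ℕ → Set where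
    []  : Route γ u u 0
    _▸_ : ∀ {w v k} → Route γ u w k → ∃[ e ] (γ e ≡ false × Joins e w v) → Route γ u v (suc k)

  module _ {γ : Strategy m} where

    infixl 5 _▸▸_
    _▸▸_ : ∀ {u w v j k} → Route γ u w j → Route γ w v k → Route γ u v (k + j)
    p ▸▸ []      = p
    p ▸▸ (q ▸ l) = (p ▸▸ q) ▸ l

    reverse : ∀ {u v k} → Route γ u v k → Route γ v u k
    reverse [] = []
    reverse {k = suc k} (p ▸ (e , off , j)) =
      subst (Route γ _ _) (+-comm k 1) ([] ▸ (e , off , swap j) ▸▸ reverse p)

    -- Listed backwards, from the end `v` to the start `u`.
    vertices : ∀ {u v k} → Route γ u v k → List (Fin n)
    vertices {u} []    = u ∷ []
    vertices {v = v} (p ▸ l) = v ∷ vertices p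

    length-vertices : ∀ {u v k} (p : Route γ u v k) → length (vertices p) ≡ suc k
    length-vertices []      = refl
    length-vertices (p ▸ _) = cong suc (length-vertices p)

    prefix : ∀ {u v x k} (p : Route γ u v k) → Unique (vertices p) → x ∈ vertices p →
             ∃[ j ] ∃ λ (q : Route γ u x j) → Unique (vertices q)
    prefix []      u       (here refl) = _ , [] , u
    prefix (p ▸ l) u       (here refl) = _ , p ▸ l , u
    prefix (p ▸ l) (_ ∷ u) (there x∈)  = prefix p u x∈

    -- Loop erasure: if the next endpoint was visited before, the route is cut back to that visit.
    simplify : ∀ {u v k} → Route γ u v k → ∃[ j ] ∃ λ (q : Route γ u v j) → Unique (vertices q)
    simplify [] = _ , [] , [] ∷ []
    simplify {v = v} (p ▸ l) with _ , q , uq ← simplify p with any? (v Fin.≟_) (vertices q)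
    ... | yes v∈ = prefix q uq v∈
    ... | no  v∉ = _ , q ▸ l , ¬Any⇒All¬ _ v∉ ∷ uq

    simple-length : ∀ {u v k} (p : Route γ u v k) → Unique (vertices p) → k ≤ n
    simple-length {k = k} p u = ≤-trans (n≤1+n k)
      (subst (_≤ n) (length-vertices p) (injective⇒≤ (Unique⇒lookup-injective u)))

    within⁺ : ∀ {u v j k} → Route γ u v j → j ≤ k → T (within E γ k u v)
    within⁺ {k = zero}  []      z≤n = fromWitness refl
    within⁺ {k = suc k} []      z≤n = Equivalence.from T-∨ (inj₁ (within⁺ {k = k} [] z≤n))
    within⁺ {u} {v} {k = suc k} (p ▸ (e , off , joins)) (s≤s j≤k) =
      Equivalence.from T-∨ (inj₂ (any⁺ _ (lose (∈-allFin e)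
        (Equivalence.from T-∧ (subst (λ b → T (not b)) (sym off) tt , last joins)))))
      where
      last : ∀ {w} → {{T (within E γ k u w)}} → Joins e w v →
             T ((within E γ k u (proj₁ (E e)) ∧ ⌊ proj₂ (E e) Fin.≟ v ⌋) ∨
                (within E γ k u (proj₂ (E e)) ∧ ⌊ proj₁ (E e) Fin.≟ v ⌋))
      last {{t}} (inj₁ eq) rewrite eq = Equivalence.from T-∨ (inj₁ (Equivalence.from T-∧ (t , fromWitness refl)))
      last {{t}} (inj₂ eq) rewrite eq = Equivalence.from T-∨ (inj₂ (Equivalence.from T-∧ (t , fromWitness refl)))
      instance
        reached : T (within E γ k u _)
        reached = within⁺ p j≤k

    within⁻ : ∀ {u v} k → T (within E γ k u v) → ∃[ j ] (j ≤ k × Route γ u v j)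
    within⁻ zero t with refl ← toWitness t = 0 , z≤n , []
    within⁻ {u} {v} (suc k) t with Equivalence.to T-∨ t
    ... | inj₁ t′ with j , j≤k , p ← within⁻ k t′ = j , m≤n⇒m≤1+n j≤k , p
    ... | inj₂ t′ with e , _ , te ← find (any⁻ _ (allFin m) t′) with γ e in off
    ...   | false with Equivalence.to T-∨ te
    ...     | inj₁ s with s₁ , s₂ ← Equivalence.to T-∧ s with j , j≤k , p ← within⁻ k s₁ =
              suc j , s≤s j≤k , p ▸ (e , off , inj₁ (cong (_ ,_) (toWitness s₂)))
    ...     | inj₂ s with s₁ , s₂ ← Equivalence.to T-∧ s with j , j≤k , p ← within⁻ k s₁ =
              suc j , s≤s j≤k , p ▸ (e , off , inj₂ (cong (_, _) (toWitness s₂)))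

    data Distance (u v : Fin n) : ℕ∞ → Set where
      finite   : ∀ {k} → Route γ u v k → (∀ {j} → Route γ u v j → k ≤ j) → Distance u v (fin k)
      infinite : (∀ {j} → ¬ Route γ u v j) → Distance u v ∞

    -- Lengths are tried in increasing order, so the first hit is the minimum. When the fuel runs
    -- out, all lengths up to `n` are excluded, and a route without repeated vertices is no longer
    -- than that.
    dist-spec : ∀ u v → Distance u v (dist E γ u v)
    dist-spec u v = go n 0 (+-identityʳ n) (λ _ → z≤n)
      where
      go : ∀ fuel k → fuel + k ≡ n → (∀ {j} → Route γ u v j → k ≤ j) → Distance u v (search E γ u v fuel k)
      go fuel k eq lb with within E γ k u v in found
      go fuel k eq lb | true with j , j≤k , p ← within⁻ k (subst T (sym found) tt) =
        finite (subst (Route γ u v) (≤-antisym j≤k (lb p)) p) lb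
      go zero k eq lb | false = infinite λ p →
        let j , q , uq = simplify p
        in subst T found (within⁺ q (≤-trans (simple-length q uq) (≤-reflexive (sym eq))))
      go (suc fuel) k eq lb | false = go fuel (suc k) (trans (+-suc fuel k) eq)
        (λ p → ≰⇒> λ j≤k → subst T found (within⁺ p j≤k))

    dist-≤ : ∀ {u v k} → Route γ u v k → dist E γ u v ≤∞ fin k
    dist-≤ {u} {v} p with dist E γ u v | dist-spec u v
    ... | _ | finite _ lb  = fin≤fin (lb p)
    ... | _ | infinite ¬p  = contradiction p ¬p

    ≤-dist : ∀ {u v c} → (∀ {k} → Route γ u v k → c ≤ k) → fin c ≤∞ dist E γ u v
    ≤-dist {u} {v} h with dist E γ u v | dist-spec u v
    ... | _ | finite p _ = fin≤fin (h p)
    ... | _ | infinite _ = _ ≤∞∞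

    dist-∞ : ∀ {u v} → (∀ {k} → ¬ Route γ u v k) → dist E γ u v ≡ ∞
    dist-∞ {u} {v} ¬p with dist E γ u v | dist-spec u v
    ... | _ | finite p _ = contradiction p ¬p
    ... | _ | infinite _ = refl

  relax : ∀ {γ γ′ : Strategy m} → (∀ f → γ f ≡ false → γ′ f ≡ false) →
          ∀ {u v k} → Route γ u v k → Route γ′ u v k
  relax h []                    = []
  relax h (p ▸ (e , off , j)) = relax h p ▸ (e , h e off , j)

-- Trees: edges are bridges and distances are finite.

only-≢ : ∀ {m} {e f : Fin m} → e ≢ f → only e f ≡ false
only-≢ {e = e} {f} e≢f with e Fin.≟ f
... | yes e≡f = contradiction e≡f e≢f
... | no _    = refl

only⁻ : ∀ {m} {e f : Fin m} → only e f ≡ false → e ≢ f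
only⁻ {e = e} off refl with no e≢e ← e Fin.≟ e = e≢e refl

module Trees {n m : ℕ} (E : Edges n m) (tree : IsTree E) where
  open Walks E

  full : Strategy m
  full _ = false

  lookup-first : ∀ {γ u v k} (p : Route γ u v k) i → toℕ i ≡ 0 → lookup (vertices p) i ≡ v
  lookup-first []      fzero _ = refl
  lookup-first (_ ▸ _) fzero _ = refl

  lookup-last : ∀ {γ u v k} (p : Route γ u v k) i → suc (toℕ i) ≡ length (vertices p) → lookup (vertices p) i ≡ u
  lookup-last []      fzero    _  = refl
  lookup-last (p ▸ _) fzero    eq with () ← trans (suc-injective eq) (length-vertices p)
  lookup-last (p ▸ _) (fsuc i) eq = lookup-last p i (suc-injective eq)

  lookup-consecutive : ∀ {γ u v k} (p : Route γ u v k) i j → toℕ j ≡ suc (toℕ i) →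
                       Adjacent E (lookup (vertices p) i) (lookup (vertices p) j)
  lookup-consecutive []                fzero    fzero    ()
  lookup-consecutive (p ▸ (e , _ , s)) fzero    (fsuc j) eq
    rewrite lookup-first p j (suc-injective eq) = e , swap s
  lookup-consecutive (p ▸ _)           (fsuc i) (fsuc j) eq = lookup-consecutive p i j (suc-injective eq)

  -- After loop erasure, a route of length 0 would make `e` a loop, one of length 1 would be an edge
  -- parallel to `e`, and a longer one would close up through `e` to a cycle.
  bridge : ∀ {e a b k} → Joins e a b → ¬ Route (only e) a b k
  bridge {e} {a} {b} joins p with simplify p
  ... | 0 , [] , _ = proj₁ (proj₁ tree) e (loop joins)
    where
    loop : Joins e a a → proj₁ (E e) ≡ proj₂ (E e)
    loop (inj₁ eq) = trans (cong proj₁ eq) (sym (cong proj₂ eq))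
    loop (inj₂ eq) = trans (cong proj₁ eq) (sym (cong proj₂ eq))
  ... | 1 , ([] ▸ (f , off , joins′)) , _ =
    only⁻ off (proj₂ (proj₁ tree) e f (parallel joins joins′))
    where
    parallel : Joins e a b → Joins f a b → E e ≡ E f ⊎ E e ≡ (proj₂ (E f) , proj₁ (E f))
    parallel (inj₁ p) (inj₁ q) = inj₁ (trans p (sym q))
    parallel (inj₁ p) (inj₂ q) = inj₂ (trans p (sym (cong (λ z → proj₂ z , proj₁ z) q)))
    parallel (inj₂ p) (inj₁ q) = inj₂ (trans p (sym (cong (λ z → proj₂ z , proj₁ z) q)))
    parallel (inj₂ p) (inj₂ q) = inj₁ (trans p (sym q))
  ... | suc (suc k) , q , uq = proj₂ (proj₂ tree) record
    { len   = length (vertices q)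
    ; len≥3 = subst (_≥ 3) (sym (length-vertices q)) (s≤s (s≤s (s≤s z≤n)))
    ; vtx   = lookup (vertices q)
    ; inj   = Unique⇒lookup-injective uq
    ; adj   = adj
    }
    where
    adj : ∀ i j → toℕ j ≡ suc (toℕ i) ⊎ (toℕ j ≡ 0 × suc (toℕ i) ≡ length (vertices q)) →
          Adjacent E (lookup (vertices q) i) (lookup (vertices q) j)
    adj i j (inj₁ next) = lookup-consecutive q i j next
    adj i j (inj₂ (first , last)) rewrite lookup-first q j first | lookup-last q i last = e , joins

  toRoute : ∀ {u v k} → Walk E u v k → ∃ (Route full u v)
  toRoute here             = _ , []
  toRoute (step (e , j) w) = _ , (([] ▸ (e , refl , j)) ▸▸ proj₂ (toRoute w))

  abstract
    distance : ∀ u v → ∃[ k ] (distT E u v ≡ fin k × Route full u v k × (∀ {j} → Route full u v j → k ≤ j))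
    distance u v with distT E u v | dist-spec {full} u v
    ... | _ | finite p lb = _ , refl , p , lb
    ... | _ | infinite ¬p = contradiction (proj₂ (toRoute (proj₂ (proj₁ (proj₂ tree) u v)))) ¬p

  d : Fin n → Fin n → ℕ
  d u v = proj₁ (distance u v)

  distT≡d : ∀ u v → distT E u v ≡ fin (d u v)
  distT≡d u v = proj₁ (proj₂ (distance u v))

  geodesic : ∀ u v → Route full u v (d u v)
  geodesic u v = proj₁ (proj₂ (proj₂ (distance u v)))

  d-≤ : ∀ {u v k} → Route full u v k → d u v ≤ k
  d-≤ {u} {v} = proj₂ (proj₂ (proj₂ (distance u v)))

  d-refl : ∀ u → d u u ≡ 0
  d-refl u = n≤0⇒n≡0 (d-≤ [])

  d-sym : ∀ u v → d u v ≡ d v u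
  d-sym u v = ≤-antisym (d-≤ (reverse (geodesic v u))) (d-≤ (reverse (geodesic u v)))

  d-triangle : ∀ u v w → d u w ≤ d u v + d v w
  d-triangle u v w = ≤-trans (d-≤ (geodesic u v ▸▸ geodesic v w)) (≤-reflexive (+-comm (d v w) (d u v)))

  d≡0 : ∀ {u v} → d u v ≡ 0 → u ≡ v
  d≡0 {u} {v} eq with [] ← subst (Route full u v) eq (geodesic u v) = refl

  d≡1 : ∀ {u v} → d u v ≡ 1 → Adjacent E u v
  d≡1 {u} {v} eq with [] ▸ (e , _ , joins) ← subst (Route full u v) eq (geodesic u v) = e , joins

  -- The two sides of an edge.

  module Cut {e : Fin m} {a b : Fin n} (joins : Joins e a b) where

    -- Induction on the route, keeping at most one crossing of `e`. By `bridge` the piece after a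
    -- crossing cannot reach the other end of `e`, so a second crossing leads straight back to the
    -- end that was left, and the first piece alone suffices.
    split : ∀ {u v k} → Route full u v k →
            (∃[ j ] (j ≤ k × Route (only e) u v j))
            ⊎ (∃[ i ] ∃[ j ] (suc (i + j) ≤ k × ((Route (only e) u a i × Route (only e) b v j)
                                              ⊎ (Route (only e) u b i × Route (only e) a v j))))
    split [] = inj₁ (0 , z≤n , [])
    split {u} {v} (_▸_ {w = w} {k = k} p (f , _ , s)) with e Fin.≟ f | split p
    ... | no e≢f | inj₁ (j , j≤ , q) = inj₁ (suc j , s≤s j≤ , q ▸ (f , only-≢ e≢f , s))
    ... | no e≢f | inj₂ (i , j , ≤k , inj₁ (q , r)) =
      inj₂ (i , suc j , s≤s (subst (_≤ k) (sym (+-suc i j)) ≤k) , inj₁ (q , r ▸ (f , only-≢ e≢f , s)))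
    ... | no e≢f | inj₂ (i , j , ≤k , inj₂ (q , r)) =
      inj₂ (i , suc j , s≤s (subst (_≤ k) (sym (+-suc i j)) ≤k) , inj₂ (q , r ▸ (f , only-≢ e≢f , s)))
    ... | yes refl | rest = cross (ends joins s) rest
      where
      ends : Joins e a b → Joins e w v → (w ≡ a × v ≡ b) ⊎ (w ≡ b × v ≡ a)
      ends (inj₁ p) (inj₁ q) with refl ← trans (sym p) q = inj₁ (refl , refl)
      ends (inj₁ p) (inj₂ q) with refl ← trans (sym p) q = inj₂ (refl , refl)
      ends (inj₂ p) (inj₁ q) with refl ← trans (sym p) q = inj₂ (refl , refl)
      ends (inj₂ p) (inj₂ q) with refl ← trans (sym p) q = inj₁ (refl , refl)
      bound : ∀ {i j} → suc (i + j) ≤ k → i ≤ suc k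
      bound {i} {j} h = ≤-trans (m≤m+n i j) (≤-trans (n≤1+n _) (≤-trans h (n≤1+n k)))
      cross : (w ≡ a × v ≡ b) ⊎ (w ≡ b × v ≡ a) →
              (∃[ j ] (j ≤ k × Route (only e) u w j))
              ⊎ (∃[ i ] ∃[ j ] (suc (i + j) ≤ k × ((Route (only e) u a i × Route (only e) b w j)
                                                ⊎ (Route (only e) u b i × Route (only e) a w j)))) →
              (∃[ j ] (j ≤ suc k × Route (only e) u v j))
              ⊎ (∃[ i ] ∃[ j ] (suc (i + j) ≤ suc k × ((Route (only e) u a i × Route (only e) b v j)
                                                    ⊎ (Route (only e) u b i × Route (only e) a v j))))
      cross (inj₁ (refl , refl)) (inj₁ (j , j≤ , q)) =
        inj₂ (j , 0 , s≤s (subst (_≤ k) (sym (+-identityʳ j)) j≤) , inj₁ (q , []))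
      cross (inj₁ (refl , refl)) (inj₂ (_ , _ , _ , inj₁ (_ , r))) = contradiction (reverse r) (bridge joins)
      cross (inj₁ (refl , refl)) (inj₂ (i , _ , ≤k , inj₂ (q , _))) = inj₁ (i , bound ≤k , q)
      cross (inj₂ (refl , refl)) (inj₁ (j , j≤ , q)) =
        inj₂ (j , 0 , s≤s (subst (_≤ k) (sym (+-identityʳ j)) j≤) , inj₂ (q , []))
      cross (inj₂ (refl , refl)) (inj₂ (i , _ , ≤k , inj₁ (q , _))) = inj₁ (i , bound ≤k , q)
      cross (inj₂ (refl , refl)) (inj₂ (_ , _ , _ , inj₂ (_ , r))) = contradiction r (bridge joins)

    -- The component of `t` in the tree without `e`.
    Side : Fin n → Fin n → Set
    Side t u = ∃ (Route (only e) u t)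

    side : ∀ u → Side a u ⊎ Side b u
    side u with split (geodesic u a)
    ... | inj₁ (_ , _ , p)               = inj₁ (_ , p)
    ... | inj₂ (_ , _ , _ , inj₁ (p , _)) = inj₁ (_ , p)
    ... | inj₂ (_ , _ , _ , inj₂ (p , _)) = inj₂ (_ , p)

    disjoint : ∀ {u} → Side a u → ¬ Side b u
    disjoint (_ , p) (_ , q) = bridge joins (reverse p ▸▸ q)

    -- If a geodesic had to cross `e`, one of its endpoints would lie on the side of `b`.
    within-side : ∀ {u v} → Side a u → Side a v → ∃[ k ] (k ≤ d u v × Route (only e) u v k)
    within-side {u} {v} su sv with split (geodesic u v)
    ... | inj₁ (k , k≤ , p) = k , k≤ , p
    ... | inj₂ (_ , _ , _ , inj₁ (_ , q)) = contradiction (_ , reverse q) (disjoint sv)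
    ... | inj₂ (_ , _ , _ , inj₂ (p , _)) = contradiction (_ , p) (disjoint su)

    -- Joining two geodesics through `e` gives the upper bound. For the lower one, `split` shows
    -- that a geodesic crosses `e` from `a` to `b`, and its two pieces are at least as long as
    -- `d u a` and `d b v`.
    d-across : ∀ {u v} → Side a u → Side b v → d u v ≡ suc (d u a + d b v)
    d-across {u} {v} su sv = ≤-antisym upper lower
      where
      upper : d u v ≤ suc (d u a + d b v)
      upper = ≤-trans (d-≤ ((geodesic u a ▸ (e , refl , joins)) ▸▸ geodesic b v))
                      (≤-reflexive (trans (+-comm (d b v) _) refl))
      forget : ∀ {x y k} → Route (only e) x y k → d x y ≤ k
      forget p = d-≤ (relax (λ _ _ → refl) p)
      lower : suc (d u a + d b v) ≤ d u v
      lower with split (geodesic u v)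
      ... | inj₁ (_ , _ , p) = contradiction (_ , p ▸▸ proj₂ sv) (disjoint su)
      ... | inj₂ (_ , _ , ≤k , inj₁ (p , q)) = ≤-trans (s≤s (+-mono-≤ (forget p) (forget q))) ≤k
      ... | inj₂ (_ , _ , _ , inj₂ (p , _)) = contradiction (_ , p) (disjoint su)

    d-far : ∀ {u} → Side a u → d u b ≡ suc (d u a)
    d-far {u} su = trans (d-across su (0 , [])) (cong suc (trans (cong (d u a +_) (d-refl b)) (+-identityʳ _)))

-- Strategies that remove at most one edge.

count-none : ∀ {m} {γ : Strategy m} → (∀ f → γ f ≡ false) → count γ ≡ 0
count-none {zero}  off = refl
count-none {suc m} off rewrite off fzero = count-none (λ f → off (fsuc f))

count-none⁻ : ∀ {m} {γ : Strategy m} → count γ ≤ 0 → ∀ f → γ f ≡ false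
count-none⁻ {suc m} {γ} c≤0 f with γ fzero in off
count-none⁻ {suc m} {γ} c≤0 fzero    | false = off
count-none⁻ {suc m} {γ} c≤0 (fsuc f) | false = count-none⁻ c≤0 f

count-single : ∀ {m} {γ : Strategy m} e → (∀ f → e ≢ f → γ f ≡ false) → count γ ≤ 1
count-single {γ = γ} fzero off with γ fzero
... | true  = ≤-reflexive (cong suc (count-none (λ f → off (fsuc f) λ ())))
... | false = ≤-trans (≤-reflexive (count-none (λ f → off (fsuc f) λ ()))) z≤n
count-single (fsuc e) off rewrite off fzero (λ ()) =
  count-single e (λ f e≢f → off (fsuc f) λ { refl → e≢f refl })

-- The edge found need not be removed: it is arbitrary if `γ` removes nothing, which is why at least
-- one edge must exist.
count-single⁻ : ∀ {m} {γ : Strategy (suc m)} → count γ ≤ 1 → ∃[ e ] (∀ f → e ≢ f → γ f ≡ false)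
count-single⁻ {zero}      _   = fzero , λ { fzero 0≢0 → contradiction refl 0≢0 }
count-single⁻ {suc m} {γ} c≤1 with γ fzero in off
... | true  = fzero , λ { fzero 0≢0 → contradiction refl 0≢0 ; (fsuc f) _ → count-none⁻ {γ = λ g → γ (fsuc g)} (s≤s⁻¹ c≤1) f }
... | false with e , h ← count-single⁻ c≤1 =
  fsuc e , λ { fzero _ → off ; (fsuc f) e≢f → h f (λ e≡f → e≢f (cong fsuc e≡f)) }

-- Medians and convexity of the total distance.

module Medians {n m : ℕ} (E : Edges n m) (tree : IsTree E) where
  open Walks E
  open Trees E tree

  d-joined : ∀ {e u v} → Joins e u v → d u v ≤ 1
  d-joined joins = d-≤ ([] ▸ (_ , refl , joins))

  total : Fin n → ℕ
  total x = sum (λ u → d u x)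

  medianCost≡total : ∀ x → medianCost E x ≡ fin (total x)
  medianCost≡total x = sum∞-fin (λ u → d u x) (λ u → distT≡d u x)

  median⁻ : ∀ {r} → IsOneMedian E r → ∀ x → total r ≤ total x
  median⁻ {r} med x = fin≤fin⁻¹ (subst₂ _≤∞_ (medianCost≡total r) (medianCost≡total x) (med x))

  median⁺ : ∀ {r} → (∀ x → total r ≤ total x) → IsOneMedian E r
  median⁺ {r} h x = subst₂ _≤∞_ (sym (medianCost≡total r)) (sym (medianCost≡total x)) (fin≤fin (h x))

  median-total : ∀ {r s} → IsOneMedian E r → IsOneMedian E s → total r ≡ total s
  median-total {r} {s} mr ms = ≤-antisym (median⁻ mr s) (median⁻ ms r)

  median-exists : Fin n → ∃ (IsOneMedian E)
  median-exists v = argmin total v (allFin n) , median⁺ (λ x →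
    All.lookup (f[argmin]≤f[xs] v (allFin n)) (∈-allFin x))

  -- Convexity along the path from `x` through `s` to `r`, summed from the same inequality for each
  -- vertex `u`. The vertex `s` alone contributes a surplus of twice `d x s`, from which
  -- `median-growth` draws its gain.
  total-convex : ∀ {e s r x} → Joins e s r → d x r ≡ suc (d x s) →
                 suc (d x s) * total s + (d x s + d x s) ≤ total x + d x s * total r
  total-convex {e} {s} {r} {x} joins far = begin
    suc K * total s + (K + K)
      ≡⟨ cong₂ _+_ (*-distribˡ-sum (suc K) (λ u → d u s)) (sym (sum-at s (K + K))) ⟩
    sum (λ u → suc K * d u s) + sum (at s (K + K))
      ≡⟨ ∑-distrib-+ (λ u → suc K * d u s) (at s (K + K)) ⟨
    sum (λ u → suc K * d u s + at s (K + K) u)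
      ≤⟨ sum-mono-≤ pointwise ⟩
    sum (λ u → d u x + K * d u r)
      ≡⟨ ∑-distrib-+ (λ u → d u x) (λ u → K * d u r) ⟩
    total x + sum (λ u → K * d u r)
      ≡⟨ cong (total x +_) (*-distribˡ-sum K (λ u → d u r)) ⟨
    total x + K * total r ∎
    where
    open ≤-Reasoning
    module S = Cut joins
    module R = Cut (swap joins)
    K = d x s
    x-side : S.Side s x
    x-side with S.side x
    ... | inj₁ p = p
    ... | inj₂ p = contradiction (trans (R.d-far p) (cong suc far)) (m≢1+n+m _ {1})
    pointwise : ∀ u → suc K * d u s + at s (K + K) u ≤ d u x + K * d u r
    -- At `s` the point mass turns the inequality into an equality. Elsewhere on the side of `s` it
    -- is the triangle inequality, and beyond `r` it is again an equality.
    pointwise u with s Fin.≟ u | S.side u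
    ... | yes refl | inj₁ p rewrite at-≡ s (K + K) | S.d-far p | d-refl s | d-sym s x =
      ≤-reflexive (identity K)
      where
      identity : ∀ K → K * 0 + (K + K) ≡ K + K * 1
      identity = solve-∀
    ... | yes refl | inj₂ p = contradiction p (S.disjoint (0 , []))
    ... | no s≢u | inj₁ p rewrite at-≢ (K + K) s≢u | S.d-far p = begin
      d u s + K * d u s + 0          ≤⟨ +-monoˡ-≤ 0 (+-monoˡ-≤ (K * d u s) (d-triangle u x s)) ⟩
      d u x + d x s + K * d u s + 0  ≡⟨ identity (d u x) K (d u s) ⟩
      d u x + K * suc (d u s)        ∎
      where
      identity : ∀ a K b → a + K + K * b + 0 ≡ a + K * suc b
      identity = solve-∀
    ... | no s≢u | inj₂ p rewrite at-≢ (K + K) s≢u | R.d-far p | R.d-across p x-side | d-sym s x =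
      ≤-reflexive (identity K (d u r))
      where
      identity : ∀ K b → suc K * suc b + 0 ≡ suc (b + K) + K * b
      identity = solve-∀

  -- At distance `k + 2`, apply `total-convex` to the last vertex `s` before `r` on the geodesic,
  -- where `total s` is at least `total r`. The surplus `2 (k + 1)` covers the required `k + 2`; at
  -- distance 1 it vanishes, hence the first alternative.
  median-growth : ∀ {r} → IsOneMedian E r → ∀ x → d x r ≤ 1 ⊎ total r + d x r ≤ total x
  median-growth {r} med x = go (geodesic x r) refl
    where
    go : ∀ {k} → Route full x r k → k ≡ d x r → k ≤ 1 ⊎ total r + k ≤ total x
    go []                       _  = inj₁ z≤n
    go ([] ▸ _)                 _  = inj₁ ≤-refl
    go {suc (suc k)} (_▸_ {w = s} p@(_ ▸ _) (_ , _ , joins)) eq =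
      inj₂ (cancel-≤ (suc k * total r) (lhs (total r) k) (+-comm (total x) _) (begin
        (suc (suc k) * total r + (2 + k)) ≤⟨ +-mono-≤ (*-monoʳ-≤ (suc (suc k)) (median⁻ med s)) (s≤s (m≤n+m (suc k) k)) ⟩
        (suc (suc k) * total s + (suc k + suc k)) ≡⟨ cong (λ z → suc z * total s + (z + z)) d-s ⟨
        (suc (d x s) * total s + (d x s + d x s)) ≤⟨ total-convex joins (trans (sym eq) (cong suc (sym d-s))) ⟩
        total x + d x s * total r ≡⟨ cong (λ z → total x + z * total r) d-s ⟩
        total x + suc k * total r ∎))
      where
      open ≤-Reasoning
      lhs : ∀ t k → suc (suc k) * t + (2 + k) ≡ suc k * t + (t + suc (suc k))
      lhs = solve-∀
      d-s : d x s ≡ suc k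
      d-s = ≤-antisym (d-≤ p) (+-cancelʳ-≤ 1 _ _ (begin
        suc k + 1       ≡⟨ trans (+-comm (suc k) 1) eq ⟩
        d x r           ≤⟨ d-triangle x s r ⟩
        d x s + d s r   ≤⟨ +-monoʳ-≤ (d x s) (d-joined joins) ⟩
        d x s + 1       ∎))

  -- Vertices separated by an edge, and leaves beyond it.

  Opposite : Fin m → Fin n → Fin n → Set
  Opposite e u w = ∃[ a ] ∃[ b ] (Joins e a b × ∃ (Route (only e) u a) × ∃ (Route (only e) w b))

  -- A vertex `w` farthest from `r` among those beyond `e` is a leaf: a second edge at `w` would
  -- lead to a vertex still farther away.
  opposite-leaf : ∀ e r → ∃[ w ] (Leaf E w × Opposite e r w)
  opposite-leaf e r = case Cut.side joins₀ r of λ where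
      (inj₁ p) → beyond joins₀ p
      (inj₂ p) → beyond (swap joins₀) p
    where
    joins₀ : Joins e (proj₁ (E e)) (proj₂ (E e))
    joins₀ = inj₁ refl
    beyond : ∀ {a b} → Joins e a b → ∃ (Route (only e) r a) → ∃[ w ] (Leaf E w × Opposite e r w)
    beyond {a} {b} joins r-side = w , is-leaf (geodesic r w) refl refl , a , b , joins , r-side , w-side
      where
      open Cut joins
      -- The value 0 on the side of `r`, and the added 1 beyond `e`, force the maximum over all
      -- vertices to lie beyond `e`.
      depth : Fin n → ℕ
      depth u with side u
      ... | inj₁ _ = 0
      ... | inj₂ _ = suc (d r u)
      w : Fin n
      w = argmax depth r (allFin n)
      depth-far : ∀ {u} → Side b u → depth u ≡ suc (d r u)
      depth-far {u} p with side u
      ... | inj₁ q = contradiction p (disjoint q)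
      ... | inj₂ _ = refl
      depth-≤ : ∀ {u} → Side b u → suc (d r u) ≤ depth w
      depth-≤ {u} p = subst (_≤ depth w) (depth-far p)
        (All.lookup (f[xs]≤f[argmax] r (allFin n)) (∈-allFin u))
      w-side : Side b w
      w-side with side w | depth-≤ {b} (0 , [])
      ... | inj₂ p | _ = p
      farthest : ∀ {u} → Side b u → d r u ≤ d r w
      farthest {u} p = s≤s⁻¹ (subst (suc (d r u) ≤_) (depth-far w-side) (depth-≤ p))
      incident : ∀ {f u v} → Joins f u v → Incident E f v
      incident (inj₁ eq) = inj₂ (cong proj₂ eq)
      incident (inj₂ eq) = inj₁ (cong proj₁ eq)
      incident⁻ : ∀ {f v} → Incident E f v → ∃[ u ] Joins f u v
      incident⁻ (inj₁ refl) = _ , inj₂ refl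
      incident⁻ (inj₂ refl) = _ , inj₁ refl
      not-farther : ∀ {g z} → Joins g z w → d r z ≢ suc (d r w)
      not-farther {g} {z} jg eq with side z
      ... | inj₂ z-side = contradiction (subst (_≤ d r w) eq (farthest z-side)) 1+n≰n
      -- Here `g` leads back across `e`, so `z` is the endpoint `a`, which is no farther from `r`
      -- than `w`.
      ... | inj₁ z-side = contradiction r-z (<⇒≱ (subst (d r w <_) (sym eq) (n<1+n (d r w))))
        where
        az≡0 : d a z ≡ 0
        az≡0 = trans (d-sym a z) (m+n≡0⇒m≡0 (d z a) (n≤0⇒n≡0 (s≤s⁻¹
                (subst (_≤ 1) (d-across z-side w-side) (d-joined jg)))))
        r-z : d r z ≤ d r w
        r-z = begin
          d r z                   ≤⟨ d-triangle r a z ⟩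
          d r a + d a z           ≡⟨ cong (d r a +_) az≡0 ⟩
          d r a + 0               ≤⟨ +-monoʳ-≤ (d r a) z≤n ⟩
          d r a + d b w           ≤⟨ n≤1+n _ ⟩
          suc (d r a + d b w)     ≡⟨ d-across r-side w-side ⟨
          d r w                   ∎
          where open ≤-Reasoning
      is-leaf : ∀ {t k} → Route full r t k → t ≡ w → k ≡ d r w → Leaf E w
      is-leaf [] r≡w _ = contradiction (subst (Side b) (sym r≡w) w-side) (disjoint r-side)
      is-leaf {k = suc k} (_▸_ {w = y} p (f , _ , jf)) refl last = f , incident jf , unique
        where
        unique : ∀ g → Incident E g w → g ≡ f
        unique g g∋w with z , jg ← incident⁻ g∋w with Cut.side jg r | g Fin.≟ f
        ... | _ | yes g≡f = g≡f
        ... | inj₂ q | _ = contradiction (Cut.d-far (swap jg) q) (not-farther jg)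
        -- If `g` led towards `r`, then `y`, joined to `w` by `f`, would lie beyond `g` and be
        -- farther from `r` than `z`; but `y` precedes `w` on a geodesic from `r`.
        ... | inj₁ q | no g≢f = contradiction (d-≤ p) (<⇒≱ (begin-strict
          k                       ≡⟨ suc-injective (trans last (Cut.d-far jg q)) ⟩
          d r z                   <⟨ s≤s (m≤m+n (d r z) (d w y)) ⟩
          suc (d r z + d w y)     ≡⟨ Cut.d-across jg q (_ , ([] ▸ (f , only-≢ g≢f , jf))) ⟨
          d r y                   ∎))
          where open ≤-Reasoning

-- Savings from a pair of locations.

module Interdiction {n m : ℕ} (E : Edges n m) (tree : IsTree E) where
  open Walks E
  open Trees E tree
  open Medians E tree

  -- A step from `x` across `e` could only end in `b`, which is closer to `w`; a step away from `w`
  -- stays on the side of `x`.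
  opposite-neighbour : ∀ {e x y w} → Opposite e x w → d x y ≤ 1 → d y w ≡ suc (d x w) → Opposite e y w
  opposite-neighbour {e} {x} {y} {w} (a , b , joins , x-side , w-side) near far with Cut.side joins y
  ... | inj₁ y-side = a , b , joins , y-side , w-side
  ... | inj₂ y-side = contradiction far (<⇒≢ (begin-strict
      d y w                 ≡⟨ cong (λ z → d z w) (sym b≡y) ⟩
      d b w                 ≤⟨ m≤n+m (d b w) (d x a) ⟩
      d x a + d b w         <⟨ n<1+n _ ⟩
      suc (d x a + d b w)   ≡⟨ Cut.d-across joins x-side w-side ⟨
      d x w                 <⟨ n<1+n _ ⟩
      suc (d x w)           ∎))
    where
    open ≤-Reasoning
    b≡y : b ≡ y
    b≡y = d≡0 (m+n≡0⇒n≡0 (d x a) (n≤0⇒n≡0 (s≤s⁻¹ (subst (_≤ 1) (Cut.d-across joins x-side y-side) near))))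

  -- Some admissible pair of locations in G(γ) costs at most t − s.
  Saves : Strategy m → ℕ → ℕ → Set
  Saves γ s t = ∃[ x ] ∃[ y ] ∃[ c ] (x ≢ y × cost2 E γ x y ≤∞ fin c × c + s ≤ t)

  -- The hypothesis compares the differences of `t` and `s` and of `t′` and `s′`, rearranged to
  -- avoid truncated subtraction.
  saves-mono : ∀ {γ s t s′ t′} → t + s′ ≤ t′ + s → Saves γ s t → Saves γ s′ t′
  saves-mono {s = s} {t} {s′} {t′} le (x , y , c , x≢y , cost , c+s≤t) =
    x , y , c , x≢y , cost , cancel-≤ s (eq s c s′) (+-comm t′ s) (≤-trans (+-monoˡ-≤ s′ c+s≤t) le)
    where
    eq : ∀ s c s′ → c + s + s′ ≡ s + (c + s′)
    eq = solve-∀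

  -- Locating at r and at the far end b of e saves d(r, b) for each of the at least 1 + d(b, w) vertices beyond e.
  opposite-saves : ∀ {γ e r w} → (∀ f → e ≢ f → γ f ≡ false) → Opposite e r w → Saves γ (d r w) (total r)
  opposite-saves {γ} {e} {r} {w} off (a , b , joins , r-side , w-side) =
    r , b , sum c , (λ { refl → disjoint r-side (0 , []) }) , cost , saving
    where
    open Cut joins
    module Flip = Cut (swap joins)
    open ≤-Reasoning
    -- Each vertex is charged to the location on its own side of `e`; `beyond` is the indicator of
    -- the far side.
    c beyond : Fin n → ℕ
    c u with side u
    ... | inj₁ _ = d u r
    ... | inj₂ _ = d u b
    beyond u with side u
    ... | inj₁ _ = 0
    ... | inj₂ _ = 1
    beyond-1 : ∀ {u} → Side b u → 1 ≤ beyond u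
    beyond-1 {u} p with side u
    ... | inj₁ q = contradiction p (disjoint q)
    ... | inj₂ _ = ≤-refl
    shorter : ∀ {u t k l} → k ≤ l → Route (only e) u t k → dist E γ u t ≤∞ fin l
    shorter k≤l p = ≤∞-trans (dist-≤ (relax (λ f ok → off f (only⁻ ok)) p)) (fin≤fin k≤l)
    cost-at : ∀ u → min∞ (dist E γ u r) (dist E γ u b) ≤∞ fin (c u)
    cost-at u with side u
    ... | inj₁ p with _ , k≤ , q ← within-side p r-side = ≤∞-trans (min∞-≤ˡ _ _) (shorter k≤ q)
    ... | inj₂ p with _ , k≤ , q ← Flip.within-side p (0 , []) = ≤∞-trans (min∞-≤ʳ (dist E γ u r) _) (shorter k≤ q)
    cost : cost2 E γ r b ≤∞ fin (sum c)
    cost = subst (cost2 E γ r b ≤∞_) (sum∞-fin c (λ _ → refl)) (sum∞-mono cost-at)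
    saving-at : ∀ u → c u + d r b * beyond u ≤ d u r
    saving-at u with side u
    ... | inj₁ _ = ≤-reflexive (trans (cong (d u r +_) (*-zeroʳ (d r b))) (+-identityʳ _))
    ... | inj₂ p rewrite Flip.d-across p r-side | d-far r-side | d-sym a r =
      ≤-reflexive (trans (cong (d u b +_) (*-identityʳ _)) (+-suc _ _))
    path : ∃[ k ] ∃ λ (p : Route (only e) b w k) → Unique (vertices p)
    path = simplify (reverse (proj₂ w-side))
    -- All vertices of a simple route from `b` to `w` avoiding `e` lie beyond `e`, since prefixes of
    -- the route connect them to `b`.
    beyond-size : suc (d b w) ≤ sum beyond
    beyond-size with k , p , u ← path = begin
      suc (d b w)           ≤⟨ s≤s (d-≤ (relax (λ _ _ → refl) p)) ⟩
      suc k                 ≡⟨ length-vertices p ⟨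
      length (vertices p)   ≤⟨ length≤sum beyond u (λ x∈ → beyond-1 (_ , reverse (proj₁ (proj₂ (prefix p u x∈))))) ⟩
      sum beyond            ∎
    saving : sum c + d r w ≤ total r
    saving = begin
      sum c + d r w                             ≡⟨ cong (sum c +_) (d-across r-side w-side) ⟩
      -- The product of `1 + d r a` and `1 + d b w` exceeds `d r w` by exactly the term added here.
      sum c + suc (d r a + d b w)               ≤⟨ +-monoʳ-≤ (sum c) (m≤m+n _ (d r a * d b w)) ⟩
      sum c + (suc (d r a + d b w) + d r a * d b w) ≡⟨ cong (sum c +_) (factor (d r a) (d b w)) ⟩
      sum c + suc (d r a) * suc (d b w)         ≡⟨ cong (λ z → sum c + z * suc (d b w)) (d-far r-side) ⟨
      sum c + d r b * suc (d b w)               ≤⟨ +-monoʳ-≤ (sum c) (*-monoʳ-≤ (d r b) beyond-size) ⟩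
      sum c + d r b * sum beyond                ≡⟨ cong (sum c +_) (*-distribˡ-sum (d r b) beyond) ⟩
      sum c + sum (λ u → d r b * beyond u)      ≡⟨ ∑-distrib-+ c (λ u → d r b * beyond u) ⟨
      sum (λ u → c u + d r b * beyond u)        ≤⟨ sum-mono-≤ saving-at ⟩
      total r                                   ∎
      where
      factor : ∀ x y → suc (x + y) + x * y ≡ suc x * suc y
      factor = solve-∀

  -- Compares two minima over the medians without computing them: each distance from a median to a
  -- leaf `w` is matched by a median at most as far from `v`.
  NearestLeaf : Fin n → Set
  NearestLeaf v = ∀ w → Leaf E w → ∀ r → IsOneMedian E r → ∃[ s ] (IsOneMedian E s × d s v ≤ d r w)

  -- Once the edge between `x` and `y` is removed, `w` is on the side of one of them, and the other
  -- is one step farther.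
  parity : ∀ {x y} w → Adjacent E x y → d y w ≡ suc (d x w) ⊎ d x w ≡ suc (d y w)
  parity {x} {y} w (e , joins) with Cut.side joins w
  ... | inj₁ p = inj₁ (trans (d-sym y w) (trans (Cut.d-far joins p) (cong suc (d-sym w x))))
  ... | inj₂ p = inj₂ (trans (d-sym x w) (trans (Cut.d-far (swap joins) p) (cong suc (d-sym w y))))

  -- Medians have equal totals, so growth by `d x y` would force this distance to be 0.
  median-diameter : ∀ {x y} → IsOneMedian E x → IsOneMedian E y → d x y ≤ 1
  median-diameter {x} {y} mx my with median-growth my x
  ... | inj₁ near   = near
  ... | inj₂ growth = ≤-trans (+-cancelˡ-≤ (total y) _ 0 (≤-trans growth
                        (≤-reflexive (trans (median-total mx my) (sym (+-identityʳ _)))))) z≤n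

  median-saves : ∀ {γ e v y} → (∀ f → e ≢ f → γ f ≡ false) → NearestLeaf v → IsOneMedian E y →
                 Saves γ (d y v) (total y)
  median-saves {γ} {e} {v} {y} off nearest my
    with w , leaf , opp ← opposite-leaf e y
    with s , ms , s-v ← nearest w leaf y my
    = go (m≤1⇒ (median-diameter my ms))
    where
    m≤1⇒ : ∀ {k} → k ≤ 1 → k ≡ 0 ⊎ k ≡ 1
    m≤1⇒ z≤n       = inj₁ refl
    m≤1⇒ (s≤s z≤n) = inj₂ refl
    via : ∀ {s} → d y s ≤ 1 → ∀ {k} → d s v ≤ k → d y v ≤ suc k
    via {s} near le = ≤-trans (d-triangle y s v) (+-mono-≤ near le)
    direct : d y v ≤ d y w → Saves γ (d y v) (total y)
    direct le = saves-mono (+-monoʳ-≤ (total y) le) (opposite-saves off opp)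
    go : d y s ≡ 0 ⊎ d y s ≡ 1 → Saves γ (d y v) (total y)
    go (inj₁ same) = direct (subst (λ z → d z v ≤ d y w) (sym (d≡0 same)) s-v)
    go (inj₂ one) with parity w (d≡1 one)
    -- The median `s` is one step farther from `w` and still opposite to it. Locating at `s` thus
    -- saves `1 + d y w`, enough to pay for the step from `y` to `s`.
    ... | inj₁ far = saves-mono
      (+-mono-≤ (≤-reflexive (median-total ms my)) (≤-trans (via (≤-reflexive one) s-v) (≤-reflexive (sym far))))
      (opposite-saves off (opposite-neighbour opp (≤-reflexive one) far))
    -- Now `s` is one step closer to `w`. Applying `nearest` again, from `s`, bounds `d y v` by
    -- `1 + d s w`, which is `d y w`.
    ... | inj₂ near with s′ , ms′ , s′-v ← nearest w leaf s ms =
      direct (≤-trans (via (median-diameter my ms′) s′-v) (≤-reflexive (sym near)))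

  nearest-leaf-saves : ∀ {γ e v} → (∀ f → e ≢ f → γ f ≡ false) → NearestLeaf v → ∀ y → Saves γ (d y v) (total y)
  nearest-leaf-saves {γ} {e} {v} off nearest y
    with r , mr ← median-exists y with total y ≤? total r
  ... | yes y≤r = median-saves off nearest (median⁺ (λ x → ≤-trans y≤r (median⁻ mr x)))
  ... | no  y≰r
    with w , leaf , opp ← opposite-leaf e r
    with s , ms , s-v ← nearest w leaf r mr =
    saves-mono (begin
      total r + d y v             ≤⟨ +-monoʳ-≤ (total r) (d-triangle y s v) ⟩
      total r + (d y s + d s v)   ≡⟨ +-assoc (total r) _ _ ⟨
      total r + d y s + d s v     ≡⟨ cong (λ t → t + d y s + d s v) (median-total mr ms) ⟩
      total s + d y s + d s v     ≤⟨ +-mono-≤ growth s-v ⟩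
      total y + d r w             ∎)
      (opposite-saves off opp)
    where
    open ≤-Reasoning
    growth : total s + d y s ≤ total y
    growth with median-growth ms y
    ... | inj₂ le   = le
    -- Within distance 1 the gain comes from `y` not being a median: its total is larger by at least
    -- 1.
    ... | inj₁ near = begin
      total s + d y s   ≤⟨ +-monoʳ-≤ (total s) near ⟩
      total s + 1       ≡⟨ trans (+-comm (total s) 1) (cong suc (median-total ms mr)) ⟩
      suc (total r)     ≤⟨ ≰⇒> y≰r ⟩
      total y           ∎

  -- Interdicting the edge at a leaf.

  module _ {v : Fin n} {e : Fin m} (leaf : ∀ f → Incident E f v → f ≡ e) where

    -- The last edge of such a route would be incident to `v`, hence equal to the removed `e`.
    isolated : ∀ {u k} → u ≢ v → ¬ Route (only e) u v k
    isolated u≢v []                     = u≢v refl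
    isolated u≢v (_ ▸ (f , off , inj₁ eq)) = only⁻ off (sym (leaf f (inj₂ (cong proj₂ eq))))
    isolated u≢v (_ ▸ (f , off , inj₂ eq)) = only⁻ off (sym (leaf f (inj₁ (cong proj₁ eq))))

    -- No vertex other than `v` can be served from `v`, and removing an edge shortens no distance to
    -- `y`. Compared with `total y`, only the term of `v` is lost.
    leaf-cost : ∀ {y c} → c + d y v ≤ total y → fin c ≤∞ cost2 E (only e) v y
    leaf-cost {y} {c} c≤ = ≤∞-trans (fin≤fin c≤sum) (subst (_≤∞ cost2 E (only e) v y)
                             (sum∞-fin g (λ _ → refl)) (sum∞-mono cost-at))
      where
      open ≤-Reasoning
      g : Fin n → ℕ
      g u = if ⌊ v Fin.≟ u ⌋ then 0 else d u y
      cost-at : ∀ u → fin (g u) ≤∞ min∞ (dist E (only e) u v) (dist E (only e) u y)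
      cost-at u with v Fin.≟ u
      ... | yes _  = 0≤∞ _
      ... | no v≢u = min∞-glb (≤-dist (λ p → contradiction p (isolated (≢-sym v≢u))))
                              (≤-dist (λ p → d-≤ (relax (λ _ _ → refl) p)))
      total-at : ∀ u → d u y ≤ g u + at v (d v y) u
      total-at u with v Fin.≟ u
      ... | yes refl = ≤-reflexive (sym (at-≡ v (d v y)))
      ... | no _     = m≤m+n _ _
      c≤sum : c ≤ sum g
      c≤sum = +-cancelʳ-≤ (d y v) _ _ (begin
        c + d y v                         ≤⟨ c≤ ⟩
        total y                           ≤⟨ sum-mono-≤ total-at ⟩
        sum (λ u → g u + at v (d v y) u)  ≡⟨ ∑-distrib-+ g (at v (d v y)) ⟩
        sum g + sum (at v (d v y))        ≡⟨ cong (sum g +_) (trans (sum-at v (d v y)) (d-sym v y)) ⟩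
        sum g + d y v                     ∎)

    cost-uncovered : ∀ {x y} → x ≢ v → y ≢ v → cost2 E (only e) x y ≡ ∞
    cost-uncovered {x} {y} x≢v y≢v = sum∞-∞ (λ u → min∞ (dist E (only e) u x) (dist E (only e) u y)) v
      (cong₂ min∞ {dist E (only e) v x} {∞} {dist E (only e) v y} {∞} (unreachable x≢v) (unreachable y≢v))
      where
      unreachable : ∀ {x} → x ≢ v → dist E (only e) v x ≡ ∞
      unreachable x≢v = dist-∞ (λ p → isolated x≢v (reverse p))

    -- Pairs that avoid `v` have infinite cost. For a pair containing `v`, `nearest-leaf-saves`
    -- supplies a pair under `γ` that costs no more, by `leaf-cost`.
    leaf-optimal : NearestLeaf v → Optimal E 1 (only e)
    leaf-optimal nearest = count-single e (λ _ → only-≢) , λ γ feasible → value2-glb E (only e) (dominated γ feasible)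
      where
      -- The argument of type `Fin m` shows that there is an edge, as `count-single⁻` requires.
      single : ∀ {m} (γ : Strategy m) → Fin m → Feasible 1 γ → ∃[ f ] (∀ g → f ≢ g → γ g ≡ false)
      single {suc m} γ _ feasible = count-single⁻ feasible
      with-v : ∀ γ → Feasible 1 γ → ∀ y → value2 E γ ≤∞ cost2 E (only e) v y
      with-v γ feasible y
        with f , off ← single γ e feasible
        with s , t , c , s≢t , cost , c≤ ← nearest-leaf-saves off nearest y =
        ≤∞-trans (value2-≤ E γ s≢t) (≤∞-trans cost (leaf-cost c≤))
      dominated : ∀ γ → Feasible 1 γ → ∀ x y → x ≢ y → value2 E γ ≤∞ cost2 E (only e) x y
      dominated γ feasible x y x≢y with x Fin.≟ v | y Fin.≟ v
      ... | yes refl | _        = with-v γ feasible y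
      ... | no _     | yes refl = ≤∞-trans (with-v γ feasible x) (sum∞-mono (λ u →
                                    min∞-glb (min∞-≤ʳ (dist E (only e) u y) _) (min∞-≤ˡ _ _)))
      ... | no x≢v   | no y≢v   = subst (value2 E γ ≤∞_) (sym (cost-uncovered x≢v y≢v)) (_ ≤∞∞)

theorem2 : ∀ (n m : ℕ) (E : Edges n m) → IsTree E → n ≥ 2 →
    ∀ (v : Fin n) → Leaf E v →
    (∀ (w : Fin n) → Leaf E w → ∀ (r : Fin n) → IsOneMedian E r →
    ∃[ r' ] (IsOneMedian E r' × distT E r' v ≤∞ distT E r w)) →
    ∀ (e : Fin m) → Incident E e v →
    Optimal E 1 (only e)
theorem2 n m E tree _ v (e₀ , _ , unique) nearest e e∋v =
  leaf-optimal (λ f f∋v → trans (unique f f∋v) (sym (unique e e∋v))) nearest′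
  where
  open Trees E tree
  open Interdiction E tree
  nearest′ : NearestLeaf v
  nearest′ w leaf r mr with s , ms , le ← nearest w leaf r mr =
    s , ms , fin≤fin⁻¹ (subst₂ _≤∞_ (distT≡d s v) (distT≡d r w) le)
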